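{- For every integer $e\ge 3$ there exists, for some $n\equiv 0\pmod{2e}$, a strongly equitable uniquely $2$-chromatic $e$-star system of order $n$.
   Context: An $e$-star is the complete bipartite graph $K_{1,e}$. An $e$-star system of order $n$ is a pair $(V,\mathcal B)$ where $|V|=n$ and $\mathcal B$ is a set of $e$-stars (subgraphs of the complete graph $K_n$ on $V$) whose edge sets partition the edge set of $K_n$. An $e$-star system is $k$-colourable if $V$ can be partitioned into $k$ sets (colour classes) such that no star in $\mathcal B$ has all its vertices in the same class; it is $k$-chromatic if it is $k$-colourable but not $(k-1)$-colourable. It is uniquely $k$-colourable if any two $k$-colourings differ only by a permutation of the colours (i.e. induce the same partition of $V$). A colouring is strongly equitable if all colour classes have the same size. A strongly equitable uniquely $k$-chromatic system is one that is $k$-chromatic, uniquely $k$-colourable, and whose $k$-colouring is strongly equitable. -}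

module Defs where

open import Data.Nat using (ℕ; suc)
open import Data.Fin using (Fin; _≟_)
open import Data.Fin.Properties using ()
open import Data.Vec using (Vec)
open import Data.Vec.Membership.Propositional using (_∈_)
open import Data.Vec.Relation.Unary.Unique.Propositional using (Unique)
open import Data.List using (length; filter; allFin)
open import Data.Product using (Σ; ∃; _×_)
open import Data.Sum using (_⊎_)
open import Relation.Binary.PropositionalEquality using (_≡_; _≢_)
open import Relation.Nullary using (¬_)
open import Function.Bundles using (_⇔_)

record Star (n e : ℕ) : Set where
  field
    centre     : Fin n
    leaves     : Vec (Fin n) e
    leavesUniq : Unique leaves
    centreNotLeaf : ¬ (centre ∈ leaves)
open Star public

EdgeIn : ∀ {n e} → Fin n → Fin n → Star n e → Set
EdgeIn u v s = (centre s ≡ u × v ∈ leaves s) ⊎ (centre s ≡ v × u ∈ leaves s)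

record StarSystem (n e : ℕ) : Set where
  field
    b     : ℕ
    stars : Fin b → Star n e
    cover : ∀ (u v : Fin n) → u ≢ v → ∃ λ i → EdgeIn u v (stars i)
    disjoint : ∀ (u v : Fin n) (i j : Fin b) →
               EdgeIn u v (stars i) → EdgeIn u v (stars j) → i ≡ j
open StarSystem public

Proper : ∀ {n e} (S : StarSystem n e) (k : ℕ) → (Fin n → Fin k) → Set
Proper S k f = ∀ (i : Fin (b S)) →
  ¬ (∀ (x : Fin _) → x ∈ leaves (stars S i) → f x ≡ f (centre (stars S i)))

Colourable : ∀ {n e} → StarSystem n e → ℕ → Set
Colourable {n} S k = Σ (Fin n → Fin k) (Proper S k)

Chromatic : ∀ {n e} → StarSystem n e → ℕ → Set
Chromatic S (suc k) = Colourable S (suc k) × ¬ Colourable S k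
Chromatic S 0 = Colourable S 0

UniquelyColourable : ∀ {n e} → StarSystem n e → ℕ → Set
UniquelyColourable {n} S k = ∀ (f g : Fin n → Fin k) → Proper S k f → Proper S k g →
  ∀ (u v : Fin n) → (f u ≡ f v) ⇔ (g u ≡ g v)

classSize : ∀ {n k} → (Fin n → Fin k) → Fin k → ℕ
classSize {n} f a = length (filter (λ v → f v ≟ a) (allFin n))

StronglyEquitable : ∀ {n k} → (Fin n → Fin k) → Set
StronglyEquitable {k = k} f = ∀ (a c : Fin k) → classSize f a ≡ classSize f c

SEUniquelyChromatic : ∀ {n e} → StarSystem n e → ℕ → Set
SEUniquelyChromatic {n} S k =
  Chromatic S k × UniquelyColourable S k ×
  Σ (Fin n → Fin k) (λ f → Proper S k f × StronglyEquitable f)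

{-# OPTIONS --safe #-}
-- Vertices come in blocks of 2e, half of each colour. A new block can be put on top of a system:
-- inside the block there is an explicit decomposition, and every new vertex is joined to all old
-- ones, whose partition into leaf sets is arbitrary as long as each of them contains a vertex of
-- the colour opposite to the centre. For e ≥ 3, a few such leaf sets may be prescribed.
-- Start with e blocks V₀; every proper colouring takes both values on each block. For every f : V₀ → 2
-- that takes both values on each block but is not constant on a colour class, add a block in which
-- some vertex centres one star with leaves in V₀ all of f-colour 0 and another with leaves all of
-- f-colour 1: then f does not extend. So every proper colouring is the given one on V₀, up to a swap,
-- and it is forced on the other blocks by stars with e leaves of the colour opposite to the centre.
module Submission where

open import Defs
open import Data.Empty using (⊥-elim)
open import Data.Fin as Fin
  using (Fin; zero; suc; splitAt; join; combine; remQuot; _↑ˡ_; _↑ʳ_; opposite; funToFin; finToFun)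
open import Data.Fin.Properties
  using (_≟_; any?; all?; pigeonhole; <⇒≢; <-cmp; ¬∀⟶∃¬; splitAt-join; join-splitAt; ↑ʳ-injective;
         remQuot-combine; combine-remQuot; combine-injective; opposite-involutive;
         finToFun-funToFin; *↔×; +↔⊎)
open import Data.List as List using (List; []; _∷_; length; filter; allFin)
open import Data.List.Membership.Propositional using (_∈_)
open import Data.List.Membership.Propositional.Properties using (∈-map⁺; ∈-allFin)
open import Data.List.Membership.Propositional.Properties.WithK using (unique∧set⇒bag)
open import Data.List.Properties using (filter-≐)
open import Data.List.Relation.Binary.BagAndSetEquality using (∼bag⇒↭)
open import Data.List.Relation.Binary.Permutation.Propositional using (_↭_)
open import Data.List.Relation.Binary.Permutation.Propositional.Properties using (↭-length; filter-↭)
open import Data.List.Relation.Unary.Unique.Propositional.Properties using (map⁺; allFin⁺)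
open import Data.Nat using (ℕ; zero; suc; _+_; _*_; _∸_; _^_; _≤_; _<_; z≤n; s≤s; z<s)
open import Data.Nat.Divisibility using (_∣_; divides)
import Data.Nat.Properties as ℕ
open import Data.Nat.Tactic.RingSolver using (solve-∀)
open import Data.Product using (Σ; ∃; ∃₂; _×_; _,_; proj₁; proj₂; uncurry; map₁)
open import Data.Product.Function.NonDependent.Propositional using (_×-↔_)
open import Data.Product.Properties using (,-injective; ≡-dec)
open import Data.Sum using (_⊎_; inj₁; inj₂; [_,_]′)
open import Data.Sum.Function.Propositional using (_⊎-↔_)
open import Data.Vec using (tabulate)
import Data.Vec.Functional as F
import Data.Vec.Membership.Propositional as Vec
import Data.Vec.Membership.Propositional.Properties as Vec
import Data.Vec.Relation.Unary.Any.Properties as Any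
import Data.Vec.Relation.Unary.Unique.Propositional.Properties as VecUnique
open import Function using (_∘_; _↔_; _⇔_; mk⇔; Inverse; Equivalence)
open import Function.Construct.Composition using (_↔-∘_)
open import Function.Construct.Identity using (↔-id)
open import Function.Definitions using (Injective)
open import Relation.Binary using (DecidableEquality; tri<; tri≈; tri>)
open import Relation.Binary.PropositionalEquality
open import Relation.Nullary using (¬_; Dec; yes; no; contradiction; ¬?)
open import Relation.Nullary.Decidable using (decidable-stable)
open import Relation.Unary using (Decidable)

-- Injectivity of maps assembled from injective parts.

Inj : {A B : Set} → (A → B) → Set
Inj = Injective _≡_ _≡_

Inj₂ : {A B C : Set} → (A → B → C) → Set
Inj₂ f = ∀ {a b a′ b′} → f a b ≡ f a′ b′ → a ≡ a′ × b ≡ b′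

remQuot-injective : ∀ {m} n → Inj (remQuot {m} n)
remQuot-injective {m} n {x} {y} eq =
  trans (sym (combine-remQuot {m} n x)) (trans (cong (uncurry combine) eq) (combine-remQuot {m} n y))

splitAt-injective : ∀ m {n} → Inj (splitAt m {n})
splitAt-injective m {n} {x} {y} eq =
  trans (sym (join-splitAt m n x)) (trans (cong (join m n) eq) (join-splitAt m n y))

[]-injective : {A B C : Set} {f : A → C} {g : B → C} →
  Inj f → Inj g → (∀ a b → f a ≢ g b) → Inj [ f , g ]′
[]-injective f-inj g-inj f≢g {inj₁ _} {inj₁ _} eq = cong inj₁ (f-inj eq)
[]-injective f-inj g-inj f≢g {inj₁ a} {inj₂ b} eq = ⊥-elim (f≢g a b eq)
[]-injective f-inj g-inj f≢g {inj₂ b} {inj₁ a} eq = ⊥-elim (f≢g a b (sym eq))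
[]-injective f-inj g-inj f≢g {inj₂ _} {inj₂ _} eq = cong inj₂ (g-inj eq)

cons-injective : {A : Set} {n : ℕ} {a : A} {f : Fin n → A} →
  Inj f → (∀ i → f i ≢ a) → Inj (a F.∷ f)
cons-injective f-inj f≢a {zero}  {zero}  eq = refl
cons-injective f-inj f≢a {zero}  {suc j} eq = ⊥-elim (f≢a j (sym eq))
cons-injective f-inj f≢a {suc i} {zero}  eq = ⊥-elim (f≢a i eq)
cons-injective f-inj f≢a {suc i} {suc j} eq = cong suc (f-inj eq)

-- Completing disjoint prescribed groups to a partition into groups of equal size.

module Completion {V : Set} (_≟_ : DecidableEquality V) where

  -- If every `β i` were a value of `f`, choosing preimages would send `Fin M` to the smaller
  -- `Fin m`. Two indices would then collide, against the injectivity of `β`.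
  fresh : ∀ {m M} (f : Fin m → V) (β : Fin M → V) → Inj β → m < M →
    ∃ λ i → ∀ a → f a ≢ β i
  fresh f β β-inj m<M with any? (λ i → all? (λ a → ¬? (f a ≟ β i)))
  ... | yes p = p
  ... | no ¬p = contradiction (β-inj βi≡βj) (<⇒≢ i<j)
    where
    hit : ∀ i → ∃ λ a → f a ≡ β i
    hit i =
      let a , ¬¬eq = ¬∀⟶∃¬ _ _ (λ a → ¬? (f a ≟ β i)) (λ f≢ → ¬p (i , f≢))
      in a , decidable-stable (f a ≟ β i) ¬¬eq
    collision = pigeonhole m<M (proj₁ ∘ hit)
    i = proj₁ collision
    j = proj₁ (proj₂ collision)
    i<j = proj₁ (proj₂ (proj₂ collision))
    βi≡βj : β i ≡ β j
    βi≡βj = trans (sym (proj₂ (hit i)))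
      (trans (cong f (proj₂ (proj₂ (proj₂ collision)))) (proj₂ (hit j)))

  freshMany : ∀ {m M} k (f : Fin m → V) (β : Fin M → V) → Inj β → m + k ≤ M →
    Σ (Fin k → V) λ h → Inj h × (∀ a b → f a ≢ h b) × (∀ b → ∃ λ i → h b ≡ β i)
  freshMany zero f β β-inj m+k≤M = (λ ()) , (λ { {()} }) , (λ _ ()) , λ ()
  freshMany {m} {M} (suc k) f β β-inj m+k≤M = β i F.∷ h ,
    cons-injective h-inj (λ b eq → f′≢h zero b (sym eq)) ,
    (λ { a zero → f≢βi a ; a (suc b) → f′≢h (suc a) b }) ,
    λ { zero → i , refl ; (suc b) → h⊆β b }
    where
    1+m+k≤M : suc m + k ≤ M
    1+m+k≤M = subst (_≤ M) (ℕ.+-suc m k) m+k≤M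
    new = fresh f β β-inj (ℕ.≤-trans (ℕ.m≤m+n (suc m) k) 1+m+k≤M)
    i = proj₁ new
    f≢βi = proj₂ new
    -- The new element joins the family to be avoided, so all later choices differ from it too. The
    -- sum of the two sizes stays the same.
    rec = freshMany k (β i F.∷ f) β β-inj 1+m+k≤M
    h = proj₁ rec
    h-inj : Inj h
    h-inj = proj₁ (proj₂ rec)
    f′≢h = proj₁ (proj₂ (proj₂ rec))
    h⊆β = proj₂ (proj₂ (proj₂ rec))

  -- A missed value put in front of `f` would give `n + 1` distinct elements, which `enc` would
  -- place injectively in `Fin n`.
  injective⇒surjective : ∀ {n} (enc : V → Fin n) → Inj enc →
    (f : Fin n → V) → Inj f → ∀ v → ∃ λ i → f i ≡ v
  injective⇒surjective {n} enc enc-inj f f-inj v with any? (λ i → f i ≟ v)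
  ... | yes p = p
  ... | no ¬p with pigeonhole (ℕ.n<1+n n) (enc ∘ (v F.∷ f))
  ...   | i , j , i<j , eq =
    contradiction (cons-injective f-inj (λ i eq → ¬p (i , eq)) {i} {j} (enc-inj eq)) (<⇒≢ i<j)

  -- The r given groups leave k more to be filled: put one fresh element satisfying P
  -- into each of these, then distribute everything else arbitrarily.
  completeGroups : (P : V → Set) → ∀ {N M} r k e′ → let e = suc e′ in N ≡ r + k →
    (ψ : Fin r → Fin e → V) → Inj₂ ψ → (∀ a → ∃ λ j → P (ψ a j)) →
    (β : Fin M → V) → Inj β → (∀ i → P (β i)) → r * e + k ≤ M →
    (α : Fin (N * e) → V) → Inj α → (enc : V → Fin (N * e)) → Inj enc →
    Σ (Fin N → Fin e → V) λ φ → Inj₂ φ × (∀ v → ∃₂ λ a j → φ a j ≡ v) ×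
      (∀ a → ∃ λ j → P (φ a j)) × (∀ a → ∃ λ a′ → ∀ j → φ a′ j ≡ ψ a j)
  completeGroups P r k e′ refl ψ ψ-inj ψ-P β β-inj β-P bound α α-inj enc enc-inj =
    φ , φ-inj , φ-sur , φ-P , λ a → a ↑ˡ k , λ j → cong (λ s → group s j) (splitAt-join r k (inj₁ a))
    where
    e = suc e′
    ψ′ : Fin (r * e) → V
    ψ′ = uncurry ψ ∘ remQuot e
    heads = freshMany k ψ′ β β-inj bound
    h = proj₁ heads
    h-inj : Inj h
    h-inj = proj₁ (proj₂ heads)
    ψ≢h : ∀ a j b → ψ a j ≢ h b
    ψ≢h a j b eq = proj₁ (proj₂ (proj₂ heads)) (combine a j) b
      (trans (cong (uncurry ψ) (remQuot-combine a j)) eq)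
    h⊆β = proj₂ (proj₂ (proj₂ heads))
    ψh : Fin (r * e + k) → V
    ψh = [ ψ′ , h ]′ ∘ splitAt (r * e)
    count : ∀ r k e′ → r * suc e′ + k + k * e′ ≡ (r + k) * suc e′
    count = solve-∀
    -- The bound holds with equality: `α` supplies `N * e` elements, exactly enough for the
    -- prescribed groups, one head in each remaining group and `e′` further members behind each
    -- head.
    tails = freshMany (k * e′) ψh α α-inj (ℕ.≤-reflexive (count r k e′))
    t = proj₁ tails
    ψh≢t = proj₁ (proj₂ (proj₂ tails))
    ψ≢t : ∀ a j b → ψ a j ≢ t b
    ψ≢t a j b eq = ψh≢t (join (r * e) k (inj₁ (combine a j))) b
      (trans (cong [ ψ′ , h ]′ (splitAt-join (r * e) k (inj₁ (combine a j))))
        (trans (cong (uncurry ψ) (remQuot-combine a j)) eq))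
    h≢t : ∀ a b → h a ≢ t b
    h≢t a b eq = ψh≢t (join (r * e) k (inj₂ a)) b
      (trans (cong [ ψ′ , h ]′ (splitAt-join (r * e) k (inj₂ a))) eq)
    group : Fin r ⊎ Fin k → Fin e → V
    group (inj₁ a) j       = ψ a j
    group (inj₂ a) zero    = h a
    group (inj₂ a) (suc j) = t (combine a j)
    group-inj : Inj₂ group
    group-inj {inj₁ a} {j} {inj₁ a′} {j′} eq = let p , q = ψ-inj eq in cong inj₁ p , q
    group-inj {inj₁ a} {j} {inj₂ a′} {zero} eq = ⊥-elim (ψ≢h a j a′ eq)
    group-inj {inj₁ a} {j} {inj₂ a′} {suc j′} eq = ⊥-elim (ψ≢t a j _ eq)
    group-inj {inj₂ a} {zero} {inj₁ a′} {j′} eq = ⊥-elim (ψ≢h a′ j′ a (sym eq))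
    group-inj {inj₂ a} {zero} {inj₂ a′} {zero} eq = cong inj₂ (h-inj eq) , refl
    group-inj {inj₂ a} {zero} {inj₂ a′} {suc j′} eq = ⊥-elim (h≢t a _ eq)
    group-inj {inj₂ a} {suc j} {inj₁ a′} {j′} eq = ⊥-elim (ψ≢t a′ j′ _ (sym eq))
    group-inj {inj₂ a} {suc j} {inj₂ a′} {zero} eq = ⊥-elim (h≢t a′ _ (sym eq))
    group-inj {inj₂ a} {suc j} {inj₂ a′} {suc j′} eq =
      let p , q = combine-injective a j a′ j′ (proj₁ (proj₂ tails) eq) in cong inj₂ p , cong suc q
    group-P : ∀ s → ∃ λ j → P (group s j)
    group-P (inj₁ a) = ψ-P a
    group-P (inj₂ a) = zero , subst P (sym (proj₂ (h⊆β a))) (β-P _)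
    φ : Fin (r + k) → Fin e → V
    φ a j = group (splitAt r a) j
    φ-inj : Inj₂ φ
    φ-inj eq = let p , q = group-inj eq in splitAt-injective r p , q
    φ-P : ∀ a → ∃ λ j → P (φ a j)
    φ-P a = group-P (splitAt r a)
    φ-sur : ∀ v → ∃₂ λ a j → φ a j ≡ v
    φ-sur v =
      -- Surjectivity is by counting: `φ` has `N * e` distinct values, and `enc` shows that there
      -- are no more elements.
      let i , eq = injective⇒surjective enc enc-inj (uncurry φ ∘ remQuot {r + k} e)
                     (λ eq → remQuot-injective {r + k} e (let p , q = φ-inj eq in cong₂ _,_ p q)) v
      in proj₁ (remQuot {r + k} e i) , proj₂ (remQuot {r + k} e i) , eq

-- Two colours, and class sizes under a colour-reversing involution.

≢⇒opposite : ∀ {a b : Fin 2} → a ≢ b → a ≡ opposite b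
≢⇒opposite {zero}     {zero}     a≢b = ⊥-elim (a≢b refl)
≢⇒opposite {zero}     {suc zero} a≢b = refl
≢⇒opposite {suc zero} {zero}     a≢b = refl
≢⇒opposite {suc zero} {suc zero} a≢b = ⊥-elim (a≢b refl)

opposite≢ : ∀ (a : Fin 2) → opposite a ≢ a
opposite≢ zero       ()
opposite≢ (suc zero) ()

≢-dichotomy : ∀ {a b : Fin 2} → a ≢ b → ∀ c → a ≡ c ⊎ b ≡ c
≢-dichotomy {a} {b} a≢b c with a ≟ c
... | yes a≡c = inj₁ a≡c
... | no  a≢c = inj₂ (trans (≢⇒opposite (a≢b ∘ sym))
  (trans (cong opposite (≢⇒opposite a≢c)) (opposite-involutive c)))

length-filter-map : {A B : Set} {P : B → Set} (P? : Decidable P) (f : A → B) (xs : List A) →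
  length (filter P? (List.map f xs)) ≡ length (filter (P? ∘ f) xs)
length-filter-map P? f [] = refl
length-filter-map P? f (x ∷ xs) with P? (f x)
... | yes _ = cong suc (length-filter-map P? f xs)
... | no  _ = length-filter-map P? f xs

map-involution-↭ : ∀ {n} (σ : Fin n → Fin n) → (∀ i → σ (σ i) ≡ i) → List.map σ (allFin n) ↭ allFin n
map-involution-↭ {n} σ σσ = ∼bag⇒↭ (unique∧set⇒bag
  (map⁺ (λ {i} {j} eq → trans (sym (σσ i)) (trans (cong σ eq) (σσ j))) (allFin⁺ n)) (allFin⁺ n)
  (mk⇔ (λ _ → ∈-allFin _) (λ _ → subst (_∈ List.map σ (allFin n)) (σσ _) (∈-map⁺ σ (∈-allFin _)))))

-- Applying `σ` only permutes `allFin n`, so it does not change a count; it turns the condition for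
-- colour `a` into the one for `opposite a`.
classSize-swap : ∀ {n} (f : Fin n → Fin 2) (σ : Fin n → Fin n) → (∀ i → σ (σ i) ≡ i) →
  (∀ i → f (σ i) ≡ opposite (f i)) → ∀ a → classSize f a ≡ classSize f (opposite a)
classSize-swap {n} f σ σσ fσ a = begin
  length (filter (λ v → f v ≟ a) (allFin n))
    ≡⟨ ↭-length (filter-↭ (λ v → f v ≟ a) (map-involution-↭ σ σσ)) ⟨
  length (filter (λ v → f v ≟ a) (List.map σ (allFin n)))
    ≡⟨ length-filter-map (λ v → f v ≟ a) σ (allFin n) ⟩
  length (filter (λ v → f (σ v) ≟ a) (allFin n))
    ≡⟨ cong length (filter-≐ (λ v → f (σ v) ≟ a) (λ v → f v ≟ opposite a) (to , from) (allFin n)) ⟩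
  length (filter (λ v → f v ≟ opposite a) (allFin n)) ∎
  where
  open ≡-Reasoning
  to : ∀ {v} → f (σ v) ≡ a → f v ≡ opposite a
  to {v} eq = trans (sym (opposite-involutive (f v))) (cong opposite (trans (sym (fσ v)) eq))
  from : ∀ {v} → f v ≡ opposite a → f (σ v) ≡ a
  from {v} eq = trans (fσ v) (trans (cong opposite eq) (opposite-involutive a))

-- The star decomposition inside a block.

module Construction (e₀ : ℕ) where

  e′ e : ℕ
  e′ = 2 + e₀
  e  = suc e′

  Block : Set
  Block = Fin 2 × Fin e

  -- The tournament on a block: all outdegrees are e, except that of ∞ = (0 , 0), which is 0.
  data Arc : Block → Block → Set where
    0→1 : ∀ {i j} → j Fin.< i → Arc (zero , i) (suc zero , j)
    1→0 : ∀ {i j} → j Fin.≤ i → Arc (suc zero , i) (zero , j)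
    1→1 : ∀ {i j} → i Fin.< j → Arc (suc zero , i) (suc zero , j)
    0→0 : ∀ {i j} → i Fin.< j → Arc (zero , suc i) (zero , suc j)
    0→∞ : ∀ {i} → Arc (zero , suc i) (zero , zero)

  Arc-asym : ∀ {x y} → Arc x y → ¬ Arc y x
  Arc-asym (0→1 j<i) (1→0 i≤j) = ℕ.<⇒≱ j<i i≤j
  Arc-asym (1→0 j≤i) (0→1 i<j) = ℕ.<⇒≱ i<j j≤i
  Arc-asym (1→1 i<j) (1→1 j<i) = ℕ.<-asym i<j j<i
  Arc-asym (0→0 i<j) (0→0 j<i) = ℕ.<-asym i<j j<i

  Arc-total : ∀ x y → x ≢ y → Arc x y ⊎ Arc y x
  Arc-total (zero , zero) (zero , zero) x≢y = ⊥-elim (x≢y refl)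
  Arc-total (zero , zero) (zero , suc j) x≢y = inj₂ 0→∞
  Arc-total (zero , suc i) (zero , zero) x≢y = inj₁ 0→∞
  Arc-total (zero , suc i) (zero , suc j) x≢y with <-cmp i j
  ... | tri< i<j _ _ = inj₁ (0→0 i<j)
  ... | tri≈ _ i≡j _ = ⊥-elim (x≢y (cong (λ k → zero , suc k) i≡j))
  ... | tri> _ _ j<i = inj₂ (0→0 j<i)
  Arc-total (zero , i) (suc zero , j) x≢y with j Fin.<? i
  ... | yes j<i = inj₁ (0→1 j<i)
  ... | no  j≮i = inj₂ (1→0 (ℕ.≮⇒≥ j≮i))
  Arc-total (suc zero , i) (zero , j) x≢y with i Fin.<? j
  ... | yes i<j = inj₂ (0→1 i<j)
  ... | no  i≮j = inj₁ (1→0 (ℕ.≮⇒≥ i≮j))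
  Arc-total (suc zero , i) (suc zero , j) x≢y with <-cmp i j
  ... | tri< i<j _ _ = inj₁ (1→1 i<j)
  ... | tri≈ _ i≡j _ = ⊥-elim (x≢y (cong (suc zero ,_) i≡j))
  ... | tri> _ _ j<i = inj₂ (1→1 j<i)

  -- One star for each vertex of outdegree `e`. Since `∞` centres none, colour 0 contributes only
  -- `e′` stars, with `i` standing for the centre `(0 , suc i)`.
  BlockStar : Set
  BlockStar = Fin e ⊎ Fin e′

  blockCentre : BlockStar → Block
  blockCentre (inj₁ i) = suc zero , i
  blockCentre (inj₂ i) = zero , suc i

  -- Slot `j` holds an out-neighbour of the centre among `(0 , j)` and `(1 , j)`. The pair that
  -- contains a centre of colour 0 offers none, so that slot takes `∞`, while slot 0 takes
  -- `(1 , 0)`.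
  blockLeaf : BlockStar → Fin e → Block
  blockLeaf (inj₁ i) j with i Fin.<? j
  ... | yes _ = suc zero , j
  ... | no  _ = zero , j
  blockLeaf (inj₂ i) zero = suc zero , zero
  blockLeaf (inj₂ i) (suc j) with <-cmp i j
  ... | tri< _ _ _ = zero , suc j
  ... | tri≈ _ _ _ = zero , zero
  ... | tri> _ _ _ = suc zero , suc j

  blockLeaf-Arc : ∀ s j → Arc (blockCentre s) (blockLeaf s j)
  blockLeaf-Arc (inj₁ i) j with i Fin.<? j
  ... | yes i<j = 1→1 i<j
  ... | no  i≮j = 1→0 (ℕ.≮⇒≥ i≮j)
  blockLeaf-Arc (inj₂ i) zero = 0→1 z<s
  blockLeaf-Arc (inj₂ i) (suc j) with <-cmp i j
  ... | tri< i<j _ _ = 0→0 i<j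
  ... | tri≈ _ _ _   = 0→∞
  ... | tri> _ _ j<i = 0→1 (s≤s j<i)

  Arc-blockLeaf : ∀ {x y} → Arc x y → ∃₂ λ s j → blockCentre s ≡ x × blockLeaf s j ≡ y
  Arc-blockLeaf (0→1 {suc i} {zero} _) = inj₂ i , zero , refl , refl
  Arc-blockLeaf (0→1 {suc i} {suc j} (s≤s j<i)) = inj₂ i , suc j , refl , eq
    where
    eq : blockLeaf (inj₂ i) (suc j) ≡ (suc zero , suc j)
    eq with <-cmp i j
    ... | tri< _ _ j≮i = ⊥-elim (j≮i j<i)
    ... | tri≈ _ _ j≮i = ⊥-elim (j≮i j<i)
    ... | tri> _ _ _   = refl
  Arc-blockLeaf (1→0 {i} {j} j≤i) = inj₁ i , j , refl , eq
    where
    eq : blockLeaf (inj₁ i) j ≡ (zero , j)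
    eq with i Fin.<? j
    ... | yes i<j = ⊥-elim (ℕ.<⇒≱ i<j j≤i)
    ... | no  _   = refl
  Arc-blockLeaf (1→1 {i} {j} i<j) = inj₁ i , j , refl , eq
    where
    eq : blockLeaf (inj₁ i) j ≡ (suc zero , j)
    eq with i Fin.<? j
    ... | yes _   = refl
    ... | no  i≮j = ⊥-elim (i≮j i<j)
  Arc-blockLeaf (0→0 {i} {j} i<j) = inj₂ i , suc j , refl , eq
    where
    eq : blockLeaf (inj₂ i) (suc j) ≡ (zero , suc j)
    eq with <-cmp i j
    ... | tri< _ _ _   = refl
    ... | tri≈ i≮j _ _ = ⊥-elim (i≮j i<j)
    ... | tri> i≮j _ _ = ⊥-elim (i≮j i<j)
  Arc-blockLeaf (0→∞ {i}) = inj₂ i , suc i , refl , eq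
    where
    eq : blockLeaf (inj₂ i) (suc i) ≡ (zero , zero)
    eq with <-cmp i i
    ... | tri< _ i≢i _ = ⊥-elim (i≢i refl)
    ... | tri≈ _ _ _   = refl
    ... | tri> _ i≢i _ = ⊥-elim (i≢i refl)

  blockCentre-injective : Inj blockCentre
  blockCentre-injective {inj₁ i} {inj₁ .i} refl = refl
  blockCentre-injective {inj₂ i} {inj₂ .i} refl = refl

  blockLeaf-injective : ∀ s → Inj (blockLeaf s)
  blockLeaf-injective (inj₁ i) {j} {j′} eq with i Fin.<? j | i Fin.<? j′
  ... | yes _ | yes _ = proj₂ (,-injective eq)
  ... | no  _ | no  _ = proj₂ (,-injective eq)
  ... | yes _ | no  _ with () ← eq
  ... | no  _ | yes _ with () ← eq
  blockLeaf-injective (inj₂ i) {zero} {zero} eq = refl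
  blockLeaf-injective (inj₂ i) {zero} {suc j′} eq with <-cmp i j′
  ... | tri< _ _ _ with () ← eq
  ... | tri≈ _ _ _ with () ← eq
  ... | tri> _ _ _ with () ← eq
  blockLeaf-injective (inj₂ i) {suc j} {zero} eq with <-cmp i j
  ... | tri< _ _ _ with () ← eq
  ... | tri≈ _ _ _ with () ← eq
  ... | tri> _ _ _ with () ← eq
  blockLeaf-injective (inj₂ i) {suc j} {suc j′} eq with <-cmp i j | <-cmp i j′
  ... | tri< _ _ _ | tri< _ _ _ = proj₂ (,-injective eq)
  ... | tri≈ _ i≡j _ | tri≈ _ i≡j′ _ = cong suc (trans (sym i≡j) i≡j′)
  ... | tri> _ _ _ | tri> _ _ _ = proj₂ (,-injective eq)
  ... | tri< _ _ _ | tri≈ _ _ _ with () ← eq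
  ... | tri< _ _ _ | tri> _ _ _ with () ← eq
  ... | tri≈ _ _ _ | tri< _ _ _ with () ← eq
  ... | tri≈ _ _ _ | tri> _ _ _ with () ← eq
  ... | tri> _ _ _ | tri< _ _ _ with () ← eq
  ... | tri> _ _ _ | tri≈ _ _ _ with () ← eq

  blockLeaf-mixed : ∀ s → ∃ λ j → proj₁ (blockLeaf s j) ≢ proj₁ (blockCentre s)
  blockLeaf-mixed (inj₁ i) = zero , λ ()
  blockLeaf-mixed (inj₂ i) = zero , λ ()

  -- Systems made of blocks, and their extension by a new block.

  V : ℕ → Set
  V q = Fin q × Block

  colour : ∀ {q} → V q → Fin 2
  colour = proj₁ ∘ proj₂

  -- Blocks are numbered from the newest, which has index `zero`; each extension moves the others up
  -- by one.
  old : ∀ {q} → V q → V (suc q)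
  old = map₁ suc

  old-injective : ∀ {q} → Inj (old {q})
  old-injective refl = refl

  _≟V_ : ∀ {q} → DecidableEquality (V q)
  _≟V_ = ≡-dec _≟_ (≡-dec _≟_ _≟_)

  opaque
    -- Position comes last, so the number of vertices has the form `N * e` with `N = 2 * q`, as
    -- `completeGroups` requires.
    encode : ∀ {q} → V q → Fin (2 * q * e)
    encode (t , c , j) = combine (combine c t) j

    decode : ∀ {q} → Fin (2 * q * e) → V q
    decode {q} i =
      let ct , j = remQuot {2 * q} e i ; c , t = remQuot {2} q ct in t , c , j

    encode-decode : ∀ {q} i → encode {q} (decode i) ≡ i
    encode-decode {q} i =
      trans (cong (λ ct → combine ct (proj₂ (remQuot {2 * q} e i))) (combine-remQuot {2} q _))
        (combine-remQuot {2 * q} e i)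

    decode-encode : ∀ {q} (v : V q) → decode (encode v) ≡ v
    decode-encode {q} (t , c , j) =
      trans (cong (λ p → let c , t = remQuot {2} q (proj₁ p) in t , c , proj₂ p)
              (remQuot-combine (combine c t) j))
        (cong (λ (c , t) → t , c , j) (remQuot-combine c t))

  encode-injective : ∀ {q} → Inj (encode {q})
  encode-injective {q} {u} {v} eq =
    trans (sym (decode-encode u)) (trans (cong decode eq) (decode-encode v))

  decode-injective : ∀ {q} → Inj (decode {q})
  decode-injective {q} {i} {j} eq =
    trans (sym (encode-decode {q} i)) (trans (cong encode eq) (encode-decode {q} j))

  -- The leaf sets of the stars that join one new centre of colour `c` to all vertices of `q` old
  -- blocks.
  record Layout (q : ℕ) (c : Fin 2) : Set where
    field
      group : Fin (2 * q) → Fin e → V q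
      inj   : Inj₂ group
      sur   : ∀ v → ∃₂ λ a j → group a j ≡ v
      mixed : ∀ a → ∃ λ j → colour (group a j) ≢ c
  open Layout

  -- Disjointness is split by orientation: `inj` excludes a repeated pair of centre and leaf, `asym`
  -- a reversed one. Taken within one star they say that leaves are distinct and differ from the
  -- centre. By `mixed`, `colour` is proper on every system from the outset.
  record System (q : ℕ) : Set₁ where
    field
      I       : Set
      size    : ℕ
      I↔      : Fin size ↔ I
      centreV : I → V q
      leafV   : I → Fin e → V q
      inj     : ∀ {s j s′ j′} → centreV s ≡ centreV s′ → leafV s j ≡ leafV s′ j′ → s ≡ s′ × j ≡ j′
      asym    : ∀ {s j s′ j′} → centreV s ≡ leafV s′ j′ → leafV s j ≢ centreV s′
      sur     : ∀ u v → u ≢ v → ∃₂ λ s j →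
                  (centreV s ≡ u × leafV s j ≡ v) ⊎ (centreV s ≡ v × leafV s j ≡ u)
      mixed   : ∀ s → ∃ λ j → colour (leafV s j) ≢ colour (centreV s)
  open System

  -- Properness in positive form: each star comes with a leaf that differs from its centre.
  record NonMono {q} (S : System q) (h : V q → Fin 2) : Set where
    constructor nonMono
    field leaf≢centre : ∀ s → ∃ λ j → h (leafV S s j) ≢ h (centreV S s)
  open NonMono

  empty : System 0
  empty = record
    { I = Fin 0 ; size = 0 ; I↔ = ↔-id _
    ; centreV = λ () ; leafV = λ ()
    ; inj = λ { {()} } ; asym = λ { {()} } ; sur = λ { (() , _) } ; mixed = λ () }

  module _ {q : ℕ} (S : System q) (L : (x : Block) → Layout q (proj₁ x)) where

    -- The old stars, the stars from new centres to old leaves, and the stars within the new block.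
    -- The three kinds cover edges with two, one and no old ends, so they cannot overlap.
    Iₑ : Set
    Iₑ = I S ⊎ ((Block × Fin (2 * q)) ⊎ BlockStar)

    centreₑ : Iₑ → V (suc q)
    centreₑ (inj₁ s)              = old (centreV S s)
    centreₑ (inj₂ (inj₁ (x , a))) = zero , x
    centreₑ (inj₂ (inj₂ s))       = zero , blockCentre s

    leafₑ : Iₑ → Fin e → V (suc q)
    leafₑ (inj₁ s) j              = old (leafV S s j)
    leafₑ (inj₂ (inj₁ (x , a))) j = old (group (L x) a j)
    leafₑ (inj₂ (inj₂ s)) j       = zero , blockLeaf s j

    injₑ : ∀ s j s′ j′ → centreₑ s ≡ centreₑ s′ → leafₑ s j ≡ leafₑ s′ j′ → s ≡ s′ × j ≡ j′
    injₑ (inj₁ s) j (inj₁ s′) j′ p q =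
      let s≡s′ , j≡j′ = inj S (old-injective p) (old-injective q) in cong inj₁ s≡s′ , j≡j′
    injₑ (inj₂ (inj₁ (x , a))) j (inj₂ (inj₁ (.x , a′))) j′ refl q =
      let a≡a′ , j≡j′ = inj (L x) (old-injective q) in cong (λ a → inj₂ (inj₁ (x , a))) a≡a′ , j≡j′
    injₑ (inj₂ (inj₂ s)) j (inj₂ (inj₂ s′)) j′ p q
      with refl ← blockCentre-injective (proj₂ (,-injective p)) =
      refl , blockLeaf-injective s (proj₂ (,-injective q))
    injₑ (inj₁ _) _ (inj₂ (inj₁ _)) _ () _
    injₑ (inj₁ _) _ (inj₂ (inj₂ _)) _ () _
    injₑ (inj₂ (inj₁ _)) _ (inj₁ _) _ () _
    injₑ (inj₂ (inj₁ _)) _ (inj₂ (inj₂ _)) _ _ ()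
    injₑ (inj₂ (inj₂ _)) _ (inj₁ _) _ () _
    injₑ (inj₂ (inj₂ _)) _ (inj₂ (inj₁ _)) _ _ ()

    asymₑ : ∀ s j s′ j′ → centreₑ s ≡ leafₑ s′ j′ → leafₑ s j ≢ centreₑ s′
    asymₑ (inj₁ s) j (inj₁ s′) j′ p q = asym S (old-injective p) (old-injective q)
    asymₑ (inj₂ (inj₂ s)) j (inj₂ (inj₂ s′)) j′ p q =
      Arc-asym (blockLeaf-Arc s j)
        (subst₂ Arc (sym (proj₂ (,-injective q))) (sym (proj₂ (,-injective p))) (blockLeaf-Arc s′ j′))
    asymₑ (inj₁ _) _ (inj₂ (inj₁ _)) _ _ ()
    asymₑ (inj₁ _) _ (inj₂ (inj₂ _)) _ () _
    asymₑ (inj₂ (inj₁ _)) _ (inj₁ _) _ () _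
    asymₑ (inj₂ (inj₁ _)) _ (inj₂ (inj₁ _)) _ () _
    asymₑ (inj₂ (inj₁ _)) _ (inj₂ (inj₂ _)) _ _ ()
    asymₑ (inj₂ (inj₂ _)) _ (inj₁ _) _ () _
    asymₑ (inj₂ (inj₂ _)) _ (inj₂ (inj₁ _)) _ () _

    surₑ : ∀ u v → u ≢ v → ∃₂ λ s j →
      (centreₑ s ≡ u × leafₑ s j ≡ v) ⊎ (centreₑ s ≡ v × leafₑ s j ≡ u)
    surₑ (zero , x) (zero , y) u≢v with Arc-total x y (u≢v ∘ cong (zero ,_))
    ... | inj₁ arc = let s , j , p , q = Arc-blockLeaf arc in
      inj₂ (inj₂ s) , j , inj₁ (cong (zero ,_) p , cong (zero ,_) q)
    ... | inj₂ arc = let s , j , p , q = Arc-blockLeaf arc in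
      inj₂ (inj₂ s) , j , inj₂ (cong (zero ,_) p , cong (zero ,_) q)
    surₑ (zero , x) (suc t , y) u≢v = let a , j , p = sur (L x) (t , y) in
      inj₂ (inj₁ (x , a)) , j , inj₁ (refl , cong old p)
    surₑ (suc t , x) (zero , y) u≢v = let a , j , p = sur (L y) (t , x) in
      inj₂ (inj₁ (y , a)) , j , inj₂ (refl , cong old p)
    surₑ (suc t , x) (suc t′ , y) u≢v with sur S (t , x) (t′ , y) (u≢v ∘ cong old)
    ... | s , j , inj₁ (p , q) = inj₁ s , j , inj₁ (cong old p , cong old q)
    ... | s , j , inj₂ (p , q) = inj₁ s , j , inj₂ (cong old p , cong old q)

    mixedₑ : ∀ s → ∃ λ j → colour (leafₑ s j) ≢ colour (centreₑ s)
    mixedₑ (inj₁ s)              = mixed S s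
    mixedₑ (inj₂ (inj₁ (x , a))) = mixed (L x) a
    mixedₑ (inj₂ (inj₂ s))       = blockLeaf-mixed s

    extend : System (suc q)
    extend = record
      { I = Iₑ
      ; size = size S + (2 * e * (2 * q) + (e + e′))
      ; I↔ = (I↔ S ⊎-↔ ((((*↔× ×-↔ ↔-id _) ↔-∘ *↔×) ⊎-↔ +↔⊎) ↔-∘ +↔⊎)) ↔-∘ +↔⊎
      ; centreV = centreₑ ; leafV = leafₑ
      ; inj = λ {s} {j} {s′} {j′} → injₑ s j s′ j′
      ; asym = λ {s} {j} {s′} {j′} → asymₑ s j s′ j′
      ; sur = surₑ ; mixed = mixedₑ }

-- Leaf sets with prescribed members.

module Stages (e₀ : ℕ) where
  open Construction e₀
  open Layout
  open System
  open NonMono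

  -- At worst the prescribed groups use up `r * e` of the `q * e` vertices of colour `opposite c`,
  -- and each of the other `2 * q ∸ r` groups needs one more. This amounts to r(e-1) ≤ q(e-2), which
  -- follows from 2r ≤ q and e ≥ 3.
  completeLayout : ∀ {q} r c → r + r ≤ q →
    (ψ : Fin r → Fin e → V q) → Inj₂ ψ → (∀ a → ∃ λ j → colour (ψ a j) ≢ c) →
    Σ (Layout q c) λ L → ∀ a → ∃ λ a′ → ∀ j → group L a′ j ≡ ψ a j
  completeLayout {q} r c 2r≤q ψ ψ-inj ψ-mixed =
    let φ , φ-inj , φ-sur , φ-mixed , φ⊇ψ =
          completeGroups (λ v → colour v ≢ c) r k e′ 2q≡r+k ψ ψ-inj ψ-mixed
            β β-inj (λ _ → opposite≢ c) bound decode (decode-injective {q}) encode encode-injective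
    in record { group = φ ; inj = φ-inj ; sur = φ-sur ; mixed = φ-mixed } , φ⊇ψ
    where
    open Completion (_≟V_ {q})
    k = 2 * q ∸ r
    2q≡r+k : 2 * q ≡ r + k
    2q≡r+k = sym (ℕ.m+[n∸m]≡n (ℕ.≤-trans (ℕ.m≤m+n r r) (ℕ.≤-trans 2r≤q (ℕ.m≤m+n q (q + 0)))))
    β : Fin (q * e) → V q
    β i = let t , j = remQuot {q} e i in t , opposite c , j
    β-inj : Inj β
    β-inj {i} {i′} eq = remQuot-injective {q} e
      (cong₂ _,_ (proj₁ (,-injective eq)) (proj₂ (,-injective (proj₂ (,-injective eq)))))
    bound : r * e + k ≤ q * e
    bound = begin
      r * e + k                ≡⟨ split₁ r k e₀ ⟩
      r * (2 + e₀) + (r + k)   ≡⟨ cong (r * (2 + e₀) +_) (sym 2q≡r+k) ⟩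
      -- This is e-1 ≤ 2(e-2), the place where e ≥ 3 enters.
      r * (2 + e₀) + 2 * q     ≤⟨ ℕ.+-monoˡ-≤ (2 * q) (ℕ.*-monoʳ-≤ r (ℕ.+-monoʳ-≤ 2 (ℕ.m≤m+n e₀ e₀))) ⟩
      r * (2 + (e₀ + e₀)) + 2 * q ≡⟨ cong (_+ 2 * q) (double r e₀) ⟩
      (r + r) * (1 + e₀) + 2 * q  ≤⟨ ℕ.+-monoˡ-≤ (2 * q) (ℕ.*-monoˡ-≤ (1 + e₀) 2r≤q) ⟩
      q * (1 + e₀) + 2 * q     ≡⟨ split₂ q e₀ ⟩
      q * e                    ∎
      where
      open ℕ.≤-Reasoning
      split₁ : ∀ r k e₀ → r * (3 + e₀) + k ≡ r * (2 + e₀) + (r + k)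
      split₁ = solve-∀
      double : ∀ r e₀ → r * (2 + (e₀ + e₀)) ≡ (r + r) * (1 + e₀)
      double = solve-∀
      split₂ : ∀ q e₀ → q * (1 + e₀) + 2 * q ≡ q * (3 + e₀)
      split₂ = solve-∀

  NonMono-old : ∀ {q} {S : System q} {L} {h} → NonMono (extend S L) h → NonMono S (h ∘ old)
  NonMono-old h! = nonMono λ s → leaf≢centre h! (inj₁ s)

  layout⇒≢ : ∀ {q} {S : System q} {L} {h} → NonMono (extend S L) h →
    ∀ x a b → (∀ j → h (old (group (L x) a j)) ≡ b) → h (zero , x) ≢ b
  layout⇒≢ h! x a b all≡b hx≡b =
    let j , leaf≢ = leaf≢centre h! (inj₂ (inj₁ (x , a))) in leaf≢ (trans (all≡b j) (sym hx≡b))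

  shift : ∀ k {q} → V q → V (k + q)
  shift k = map₁ (k ↑ʳ_)

  shift-injective : ∀ k {q} → Inj (shift k {q})
  shift-injective k eq = cong₂ _,_ (↑ʳ-injective k _ _ (proj₁ (,-injective eq))) (proj₂ (,-injective eq))

  -- Base blocks and reference blocks.

  Spread : ∀ {q} → (V q → Fin 2) → Set
  Spread f = ∀ t a → ∃₂ λ c j → f (t , c , j) ≡ a

  Spread? : ∀ {q} (f : V q → Fin 2) → Dec (Spread f)
  Spread? f = all? λ t → all? λ a → any? λ c → any? λ j → f (t , c , j) ≟ a

  -- No leaf set is prescribed here. The case `q = e` is the one built upon: one vertex from each of
  -- `e` blocks then makes a leaf set.
  base : ∀ q → System q
  base zero    = empty
  base (suc q) = extend (base q)
    (λ (c , _) → proj₁ (completeLayout 0 c z≤n (λ ()) (λ { {()} }) (λ ())))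

  -- Each block contains a star, whose centre and some leaf receive different values, hence both
  -- values.
  base-spread : ∀ q {h} → NonMono (base q) h → Spread h
  base-spread (suc q) h! (suc t) a = base-spread q (NonMono-old h!) t a
  base-spread (suc q) h! zero a with leaf≢centre h! (inj₂ (inj₂ (inj₁ zero)))
  ... | j , h≢ with ≢-dichotomy h≢ a
  ...   | inj₁ leaf≡a   = _ , _ , leaf≡a
  ...   | inj₂ centre≡a = _ , _ , centre≡a

  pureLayout : ∀ {q} c → 2 ≤ q → (g : Fin e → V q) → Inj g → (∀ j → colour (g j) ≡ opposite c) →
    Σ (Layout q c) λ L → ∃ λ a → ∀ j → group L a j ≡ g j
  pureLayout c 2≤q g g-inj g-colour =
    let L , L⊇ = completeLayout 1 c 2≤q (λ _ → g) (λ { {zero} {_} {zero} eq → refl , g-inj eq })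
                   (λ _ → zero , λ eq → opposite≢ c (trans (sym (g-colour zero)) eq))
    in L , L⊇ zero

  -- One colour class of the block that was newest before the last `k` blocks were added.
  half : ∀ k {q} → Fin 2 → Fin e → V (k + suc q)
  half k c j = shift k (zero , c , j)

  half-injective : ∀ k {q} c → Inj (half k {q} c)
  half-injective k c eq = proj₂ (,-injective (proj₂ (,-injective (shift-injective k eq))))

  halfLayout : ∀ k {q} c → Σ (Layout (k + (2 + q)) c) λ L →
    ∃ λ a → ∀ j → group L a j ≡ half k (opposite c) j
  halfLayout k {q} c = pureLayout c (ℕ.≤-trans (s≤s (s≤s z≤n)) (ℕ.m≤n+m (2 + q) k))
    (half k (opposite c)) (half-injective k (opposite c)) (λ _ → refl)

  -- Each new vertex of colour `c` centres a star whose leaves are the class `opposite c` of the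
  -- newest base block, which ties its value to that block.
  refs : ∀ k → System (k + e)
  refs zero    = base e
  refs (suc k) = extend (refs k) (λ (c , _) → proj₁ (halfLayout k c))

  module _ (H : Fin 2 → Fin 2) (H≢ : ∀ c → H (opposite c) ≢ H c) where

    ≢H-opposite : ∀ {a} c → a ≢ H (opposite c) → a ≡ H c
    ≢H-opposite c a≢ with ≢-dichotomy (a≢ ∘ sym) (H c)
    ... | inj₁ eq = ⊥-elim (H≢ c eq)
    ... | inj₂ eq = eq

    -- `H` is the identity or the swap. The leaves of the prescribed star all take the value
    -- `H (opposite c)`, so its centre must take the other value, `H c`.
    refs-forced : ∀ k {h} → NonMono (refs k) h → (∀ v → h (shift k v) ≡ H (colour v)) →
      ∀ v → h v ≡ H (colour v)
    refs-forced zero    h! forced v = forced v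
    refs-forced (suc k) h! forced (suc t , x) =
      refs-forced k (NonMono-old h!) forced (t , x)
    refs-forced (suc k) {h} h! forced (zero , x@(c , i)) =
      let L , a , eq = halfLayout k c
      in ≢H-opposite c (layout⇒≢ h! x a (H (opposite c))
           (λ j → trans (cong (h ∘ old) (eq j)) (forced (zero , opposite c , j))))

  -- Blocks that exclude a given colouring of the base.

  -- Spread offers a vertex of value `a` in every block. In block `t₀` the given vertex of colour
  -- `d` is taken instead, so that the set can serve as a mixed leaf set for a centre of the colour
  -- opposite to `d`.
  transversal : ∀ {f : V e → Fin 2} {a} → Spread f → ∀ d → (∃₂ λ t i → f (t , d , i) ≡ a) →
    Σ (Fin e → V e) λ ℓ → (∀ t → proj₁ (ℓ t) ≡ t) × (∀ t → f (ℓ t) ≡ a) × (∃ λ t → colour (ℓ t) ≡ d)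
  transversal {f} {a} spread d (t₀ , i₀ , eq₀) =
    proj₁ ∘ pick , proj₁ ∘ proj₂ ∘ pick , proj₁ ∘ proj₂ ∘ proj₂ ∘ pick ,
    t₀ , proj₂ (proj₂ (proj₂ (pick t₀))) refl
    where
    pick : ∀ t → Σ (V e) λ v → proj₁ v ≡ t × f v ≡ a × (t ≡ t₀ → colour v ≡ d)
    pick t with t ≟ t₀
    ... | yes refl = (t₀ , d , i₀) , refl , eq₀ , λ _ → refl
    ... | no  t≢t₀ = let c , j , eq = spread t a in (t , c , j) , refl , eq , λ t≡t₀ → ⊥-elim (t≢t₀ t≡t₀)

  Splits : (V e → Fin 2) → Fin 2 → Set
  Splits f d = ∀ a → ∃₂ λ t i → f (t , d , i) ≡ a

  Splits? : ∀ f d → Dec (Splits f d)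
  Splits? f d = all? λ a → any? λ t → any? λ i → f (t , d , i) ≟ a

  emb : ∀ n → V e → V (n + (3 + e))
  emb n = shift n ∘ shift 3

  -- The first group forces the new vertices as in `refs`; the second part supplies one leaf set of
  -- constant `f`-value for each of the two values. It is conditional because a layout is needed for
  -- every `f`, including those that the base or properness of `colour` does not let it exclude.
  KillLayout : ∀ n (f : V e → Fin 2) (c : Fin 2) → Set
  KillLayout n f c = Σ (Layout (n + (3 + e)) c) λ L →
    (∃ λ k → ∀ j → group L k j ≡ half n (opposite c) j) ×
    (Spread f → Splits f (opposite c) →
      ∀ a → ∃ λ k → ∀ j → ∃ λ u → group L k j ≡ emb n u × f u ≡ a)

  6≤ : ∀ n → 6 ≤ n + (3 + e)
  6≤ n = ℕ.≤-trans (s≤s (s≤s (s≤s (s≤s (s≤s (s≤s z≤n)))))) (ℕ.m≤n+m (3 + e) n)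

  half≢emb : ∀ n c j u → half n c j ≢ emb n u
  half≢emb n c j u eq with () ← proj₁ (,-injective (shift-injective n eq))

  killLayout : ∀ n f c → KillLayout n f c
  killLayout n f c with Spread? f | Splits? f (opposite c)
  ... | no ¬spread | _ =
    let L , a = halfLayout n c in L , a , λ spread → ⊥-elim (¬spread spread)
  ... | yes _ | no ¬splits =
    let L , a = halfLayout n c in L , a , λ _ splits → ⊥-elim (¬splits splits)
  ... | yes spread | yes splits =
    let L , L⊇ = completeLayout 3 c (6≤ n) ψ ψ-inj ψ-mixed
    in L , L⊇ zero , λ _ _ a → proj₁ (L⊇ (suc a)) ,
       λ j → ℓ a j , proj₂ (L⊇ (suc a)) j , fℓ≡ a j
    where
    tr = λ a → transversal spread (opposite c) (splits a)
    ℓ : Fin 2 → Fin e → V e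
    ℓ a = proj₁ (tr a)
    fℓ≡ : ∀ a j → f (ℓ a j) ≡ a
    fℓ≡ a = proj₁ (proj₂ (proj₂ (tr a)))
    ψ : Fin 3 → Fin e → V (n + (3 + e))
    ψ zero    j = half n (opposite c) j
    ψ (suc a) j = emb n (ℓ a j)
    ψ-inj : Inj₂ ψ
    ψ-inj {zero} {j} {zero} {j′} eq = refl , half-injective n _ eq
    ψ-inj {zero} {j} {suc a} {j′} eq = ⊥-elim (half≢emb n _ j _ eq)
    ψ-inj {suc a} {j} {zero} {j′} eq = ⊥-elim (half≢emb n _ j′ _ (sym eq))
    -- The two transversals are disjoint because `f` takes different values on them; within one of
    -- them the block index recovers the position.
    ψ-inj {suc a} {j} {suc a′} {j′} eq =
      cong suc (trans (sym (fℓ≡ a j)) (trans (cong f ℓ≡ℓ) (fℓ≡ a′ j′))) ,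
      trans (sym (proj₁ (proj₂ (tr a)) j)) (trans (cong proj₁ ℓ≡ℓ) (proj₁ (proj₂ (tr a′)) j′))
      where
      ℓ≡ℓ : ℓ a j ≡ ℓ a′ j′
      ℓ≡ℓ = shift-injective 3 (shift-injective n eq)
    ψ-mixed : ∀ a → ∃ λ j → colour (ψ a j) ≢ c
    ψ-mixed zero = zero , opposite≢ c
    ψ-mixed (suc a) =
      let j , eq = proj₂ (proj₂ (proj₂ (tr a))) in j , λ col≡c → opposite≢ c (trans (sym eq) col≡c)

  -- Three reference blocks bring the number of old blocks to 6, as needed to prescribe three groups;
  -- the group in the newest of them is disjoint from any two groups in the first e blocks.
  kills : ∀ n → (Fin n → V e → Fin 2) → System (n + (3 + e))
  kills zero    F = refs 3
  kills (suc n) F = extend (kills n (F ∘ suc)) (λ (c , _) → proj₁ (killLayout n (F zero) c))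

  kills-refs : ∀ n F {h} → NonMono (kills n F) h → NonMono (refs 3) (h ∘ shift n)
  kills-refs zero    F h! = h!
  kills-refs (suc n) F h! = kills-refs n (F ∘ suc) (NonMono-old h!)

  refs-base : ∀ k {h} → NonMono (refs k) h → NonMono (base e) (h ∘ shift k)
  refs-base zero    h! = h!
  refs-base (suc k) h! = refs-base k (NonMono-old h!)

  killed : ∀ n F i {h} → NonMono (kills n F) h → (∀ u → F i u ≡ h (emb n u)) →
    Spread (F i) → ∀ c → ¬ Splits (F i) (opposite c)
  killed (suc n) F (suc i) h! = killed n (F ∘ suc) i (NonMono-old h!)
  killed (suc n) F zero {h} h! F≗h spread c splits =
    let L , _ , kill = killLayout n (F zero) c
        -- Of the two prescribed stars at this centre, the one whose leaves have the value that `h`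
        -- gives the centre is monochromatic.
        a            = h (zero , c , zero)
        k , leaves   = kill spread splits a
    in layout⇒≢ h! (c , zero) k a
         (λ j → let u , leaf≡u , Fu≡a = leaves j in
           trans (cong (h ∘ old) leaf≡u) (trans (sym (F≗h u)) Fu≡a))
         refl

  kills-forced : ∀ n F (H : Fin 2 → Fin 2) → (∀ c → H (opposite c) ≢ H c) →
    ∀ {h} → NonMono (kills n F) h → (∀ v → h (shift n v) ≡ H (colour v)) → ∀ v → h v ≡ H (colour v)
  kills-forced zero    F H H≢ h! forced v = forced v
  kills-forced (suc n) F H H≢ h! forced (suc t , x) =
    kills-forced n (F ∘ suc) H H≢ (NonMono-old h!) forced (t , x)
  kills-forced (suc n) F H H≢ {h} h! forced (zero , x@(c , i)) =
    let L , (k , eq) , _ = killLayout n (F zero) c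
    in ≢H-opposite H H≢ c (layout⇒≢ h! x k (H (opposite c))
         (λ j → trans (cong (h ∘ old) (eq j)) (forced (zero , opposite c , j))))

  -- Every proper colouring is `colour` up to a swap.

  Exhaustive : ∀ {n} → (Fin n → V e → Fin 2) → Set
  Exhaustive F = ∀ (f : V e → Fin 2) → ∃ λ i → ∀ u → F i u ≡ f u

  determined : ∀ n (F : Fin n → V e → Fin 2) → Exhaustive F → ∀ {h} → NonMono (kills n F) h →
    Σ (Fin 2 → Fin 2) λ H → (∀ c → H (opposite c) ≢ H c) × (∀ v → h v ≡ H (colour v))
  determined n F exhaustive {h} h! = H , H≢ ,
    kills-forced n F H H≢ h!
      (refs-forced H H≢ 3 (kills-refs n F h!) f≡H)
    where
    f : V e → Fin 2
    f = h ∘ emb n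
    f-spread : Spread f
    f-spread = base-spread e (refs-base 3 (kills-refs n F h!))
    code = proj₁ (exhaustive f)
    code≗f : ∀ u → F code u ≡ f u
    code≗f = proj₂ (exhaustive f)
    ¬splits : ∀ d → ¬ Splits f d
    ¬splits d splits = killed n F code h! code≗f
      (λ t a → let c , j , eq = f-spread t a in c , j , trans (code≗f _) eq)
      -- A centre of colour `opposite d` excludes splitting of the class opposite to it, which is
      -- `d`.
      (opposite d)
      (λ a → let t , i , eq = splits a in t , i ,
        trans (code≗f (t , _ , i)) (trans (cong (λ d → f (t , d , i)) (opposite-involutive d)) eq))
    f-const : ∀ d t i t′ i′ → f (t , d , i) ≡ f (t′ , d , i′)
    f-const d t i t′ i′ with f (t , d , i) ≟ f (t′ , d , i′)
    ... | yes eq = eq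
    -- Two distinct elements of `Fin 2` are all of it, so the class `d` would be split.
    ... | no neq = ⊥-elim (¬splits d value)
      where
      value : ∀ a → ∃₂ λ t i → f (t , d , i) ≡ a
      value a with ≢-dichotomy neq a
      ... | inj₁ eq = t , i , eq
      ... | inj₂ eq = t′ , i′ , eq
    H : Fin 2 → Fin 2
    H c = f (zero , c , zero)
    f≡H : ∀ v → f v ≡ H (colour v)
    f≡H (t , c , j) = f-const c t j zero zero
    H≢ : ∀ c → H (opposite c) ≢ H c
    -- If `H` agreed on both colours, `f` would be constant on a block, contrary to `f-spread`.
    H≢ c eq =
      let d , j , f≡ = f-spread zero (opposite (H c))
      in opposite≢ (H c) (trans (sym f≡) (trans (f≡H (zero , d , j)) (const d)))
      where
      const : ∀ d → H d ≡ H c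
      const d with d ≟ c
      ... | yes d≡c = cong H d≡c
      ... | no  d≢c = trans (cong H (≢⇒opposite d≢c)) eq

  -- The base has `2 * e * e` vertices, so numbers below `2 ^ (2 * e * e)` code all its two-valued
  -- functions, up to pointwise equality.
  allColourings : Fin (2 ^ (2 * e * e)) → V e → Fin 2
  allColourings i = finToFun i ∘ encode

  allColourings-exhaustive : Exhaustive allColourings
  allColourings-exhaustive f = funToFin (f ∘ decode {e}) ,
    λ u → trans (finToFun-funToFin (f ∘ decode {e}) (encode u)) (cong f (decode-encode u))

-- Passage to star systems on `Fin`.

module Transfer (e₀ : ℕ) where
  open Construction e₀
  open Stages e₀

  module _ {q} (S : System q) where
    open System S
    open Inverse I↔ using (to; from; strictlyInverseˡ; strictlyInverseʳ)

    ∈-leaves⁻ : ∀ {x} s → x Vec.∈ tabulate (encode ∘ leafV s) → ∃ λ j → x ≡ encode (leafV s j)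
    ∈-leaves⁻ s = Any.tabulate⁻ {f = encode ∘ leafV s}

    ∈-leaves⁺ : ∀ s j → encode (leafV s j) Vec.∈ tabulate (encode ∘ leafV s)
    ∈-leaves⁺ s j = Vec.∈-tabulate⁺ (encode ∘ leafV s) j

    star : I → Star (2 * q * e) e
    star s = record
      { centre = encode (centreV s)
      ; leaves = tabulate (encode ∘ leafV s)
      ; leavesUniq = VecUnique.tabulate⁺ (λ eq → proj₂ (inj refl (encode-injective eq)))
      ; centreNotLeaf = λ c∈ → let j , eq = ∈-leaves⁻ s c∈ in
          asym (encode-injective eq) (sym (encode-injective eq)) }

    EdgeIn-sound : ∀ {u v s} → EdgeIn u v (star s) → ∃ λ j →
      (encode (centreV s) ≡ u × encode (leafV s j) ≡ v) ⊎ (encode (centreV s) ≡ v × encode (leafV s j) ≡ u)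
    EdgeIn-sound {s = s} (inj₁ (c≡ , ∈l)) = let j , eq = ∈-leaves⁻ s ∈l in j , inj₁ (c≡ , sym eq)
    EdgeIn-sound {s = s} (inj₂ (c≡ , ∈l)) = let j , eq = ∈-leaves⁻ s ∈l in j , inj₂ (c≡ , sym eq)

    -- If both stars orient the edge in the same way, `inj` identifies them; if they orient it
    -- oppositely, `asym` is contradicted.
    encoded-disjoint : ∀ u v s s′ → EdgeIn u v (star s) → EdgeIn u v (star s′) → s ≡ s′
    encoded-disjoint u v s s′ uv uv′ with EdgeIn-sound {s = s} uv | EdgeIn-sound {s = s′} uv′
    ... | j , inj₁ (refl , refl) | j′ , inj₁ (p , q) =
      proj₁ (inj (encode-injective (sym p)) (encode-injective (sym q)))
    ... | j , inj₁ (refl , refl) | j′ , inj₂ (p , q) =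
      ⊥-elim (asym (encode-injective (sym q)) (encode-injective (sym p)))
    ... | j , inj₂ (refl , refl) | j′ , inj₁ (p , q) =
      ⊥-elim (asym (encode-injective (sym q)) (encode-injective (sym p)))
    ... | j , inj₂ (refl , refl) | j′ , inj₂ (p , q) =
      proj₁ (inj (encode-injective (sym p)) (encode-injective (sym q)))

    encoded-cover : ∀ u v → u ≢ v → ∃ λ i → EdgeIn u v (star (to i))
    encoded-cover u v u≢v
      with sur (decode u) (decode v) (u≢v ∘ decode-injective {q})
    ... | s , j , inj₁ (p , r) = from s , subst (EdgeIn u v ∘ star) (sym (strictlyInverseˡ s))
      (inj₁ (trans (cong encode p) (encode-decode {q} u) ,
        subst (Vec._∈ _) (trans (cong encode r) (encode-decode {q} v)) (∈-leaves⁺ s j)))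
    ... | s , j , inj₂ (p , r) = from s , subst (EdgeIn u v ∘ star) (sym (strictlyInverseˡ s))
      (inj₂ (trans (cong encode p) (encode-decode {q} v) ,
        subst (Vec._∈ _) (trans (cong encode r) (encode-decode {q} u)) (∈-leaves⁺ s j)))

    starSystem : StarSystem (2 * q * e) e
    starSystem = record
      { b = size
      ; stars = star ∘ to
      ; cover = encoded-cover
      ; disjoint = λ u v i j uv uv′ → trans (sym (strictlyInverseʳ i))
          (trans (cong from (encoded-disjoint u v (to i) (to j) uv uv′)) (strictlyInverseʳ j)) }

    -- `Proper` only denies that a star is monochromatic; a differing leaf can be found because
    -- there are finitely many leaves and equality of colours is decidable.
    Proper⇒NonMono : ∀ {f} → Proper starSystem 2 f → NonMono S (f ∘ encode)
    Proper⇒NonMono {f} f! = nonMono λ s → ¬∀⟶∃¬ _ _ (λ j → f (encode (leafV s j)) ≟ f (encode (centreV s)))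
      λ mono → f! (from s) λ x x∈ →
        let j , eq = ∈-leaves⁻ _ x∈
        in trans (cong f eq) (subst (λ s → f (encode (leafV s j)) ≡ f (encode (centreV s)))
             (sym (strictlyInverseˡ s)) (mono j))

    NonMono⇒Proper : ∀ {f} → (∀ s → ∃ λ j → f (encode (leafV s j)) ≢ f (encode (centreV s))) →
      Proper starSystem 2 f
    NonMono⇒Proper f! i mono = let j , neq = f! (to i) in neq (mono _ (∈-leaves⁺ (to i) j))

    colouring : Fin (2 * q * e) → Fin 2
    colouring = colour {q} ∘ decode

    colouring-proper : Proper starSystem 2 colouring
    colouring-proper = NonMono⇒Proper λ s → let j , neq = mixed s in
      j , λ eq → neq (trans (sym (cong (colour {q}) (decode-encode (leafV s j))))
                     (trans eq (cong (colour {q}) (decode-encode (centreV s)))))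

    -- Exchanging the two vertices that share a block and a position is an involution that reverses
    -- colours.
    colouring-equitable : StronglyEquitable colouring
    colouring-equitable a c with a ≟ c
    ... | yes refl = refl
    ... | no  a≢c  = trans (classSize-swap colouring swap swap-swap colouring-swap a)
                       (cong (classSize colouring) (sym (≢⇒opposite (a≢c ∘ sym))))
      where
      flip : V q → V q
      flip (t , c , j) = t , opposite c , j
      flip-flip : ∀ v → flip (flip v) ≡ v
      flip-flip (t , c , j) = cong (λ c → t , c , j) (opposite-involutive c)
      swap : Fin (2 * q * e) → Fin (2 * q * e)
      swap = encode ∘ flip ∘ decode
      swap-swap : ∀ i → swap (swap i) ≡ i
      swap-swap i = trans (cong (encode ∘ flip) (decode-encode {q} (flip (decode {q} i))))
        (trans (cong encode (flip-flip (decode {q} i))) (encode-decode {q} i))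
      colouring-swap : ∀ i → colouring (swap i) ≡ opposite (colouring i)
      colouring-swap i = cong (colour {q}) (decode-encode {q} (flip (decode {q} i)))

    not-1-colourable : I → ¬ Colourable starSystem 1
    not-1-colourable s (f , f!) = f! (from s) λ x _ → Fin1 (f x) _
      where
      Fin1 : (a b : Fin 1) → a ≡ b
      Fin1 zero zero = refl

  -- Since `H` separates the two colours, each proper colouring induces the same partition as
  -- `colour`; `f` and `g` are compared through it.
  determined⇒unique : ∀ {q} (S : System q) →
    (∀ {h} → NonMono S h →
      Σ (Fin 2 → Fin 2) λ H → (∀ c → H (opposite c) ≢ H c) × (∀ v → h v ≡ H (colour v))) →
    UniquelyColourable (starSystem S) 2
  determined⇒unique {q} S det f g f! g! u v = mk⇔ (Equivalence.from (same g g!) ∘ Equivalence.to (same f f!))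
                             (Equivalence.from (same f f!) ∘ Equivalence.to (same g g!))
    where
    col = colouring S
    same : ∀ f → Proper (starSystem S) 2 f → (f u ≡ f v) ⇔ (col u ≡ col v)
    same f f! with det (Proper⇒NonMono S f!)
    ... | H , H≢ , forced = mk⇔ to from
      where
      f≡ : ∀ u → f u ≡ H (col u)
      f≡ u = trans (sym (cong f (encode-decode {q} u))) (forced (decode u))
      from : col u ≡ col v → f u ≡ f v
      from eq = trans (f≡ u) (trans (cong H eq) (sym (f≡ v)))
      to : f u ≡ f v → col u ≡ col v
      to eq with col u ≟ col v
      ... | yes p = p
      ... | no ¬p = ⊥-elim (H≢ (col v) (trans (cong H (sym (≢⇒opposite ¬p)))
                      (trans (sym (f≡ u)) (trans eq (f≡ v)))))

  kills-star : ∀ n F → System.I (kills n F)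
  kills-star zero    F = inj₂ (inj₂ (inj₁ zero))
  kills-star (suc n) F = inj₂ (inj₂ (inj₁ zero))

  exhaustive⇒system : ∀ {n F} → Exhaustive {n} F →
    Σ ℕ (λ n → (2 * e ∣ n) × Σ (StarSystem n e) (λ S → SEUniquelyChromatic S 2))
  exhaustive⇒system {n} {F} exhaustive =
    2 * q * e , divides q (rearrange q e) , starSystem S ,
    ((colouring S , colouring-proper S) , not-1-colourable S (kills-star n F)) ,
    determined⇒unique S (determined n F exhaustive) ,
    colouring S , colouring-proper S , colouring-equitable S
    where
    q = n + (3 + e)
    S = kills n F
    rearrange : ∀ q e → 2 * q * e ≡ q * (2 * e)
    rearrange = solve-∀

theorem4p1 : ∀ (e : ℕ) → 3 ≤ e →
    Σ ℕ (λ n → (2 * e ∣ n) × Σ (StarSystem n e) (λ S → SEUniquelyChromatic S 2))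
theorem4p1 (suc (suc (suc e₀))) (s≤s (s≤s (s≤s _))) =
  exhaustive⇒system allColourings-exhaustive
  where
  open Stages e₀
  open Transfer e₀
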